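{- Every minimally $1$-tough graph of order $n$ with girth $4$ has a vertex of degree at most $\frac{n+6}{4}$.
   Context: All graphs are finite, simple and undirected. The order $n$ of a graph is its number of vertices; the girth is the length of a shortest cycle. For a graph $G$ and $S\subseteq V(G)$, $w(G-S)$ denotes the number of connected components of $G-S$. The toughness of a noncomplete graph $G$ is $\tau(G)=\min\left\{\frac{|S|}{w(G-S)} : S\subseteq V(G),\ w(G-S)\ge 2\right\}$, and $\tau(G)=+\infty$ if $G$ is complete. A graph $G$ is minimally $t$-tough if $\tau(G)=t$ and $\tau(G-e)<t$ for every edge $e\in E(G)$, where $G-e$ is $G$ with the edge $e$ deleted. -}

module Defs where

open import Data.Bool using (if_then_else_)
import Data.Bool.Properties as Bool
open import Data.Fin using (Fin; zero; suc; inject₁; fromℕ)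
import Data.Fin.Properties as Fin
open import Data.Fin.Subset using (Subset; Side; inside; outside; _∉_; ∣_∣)
open import Data.Fin.Subset.Properties using (_∈?_)
open import Data.Integer using (+_)
open import Data.List using (List; []; _∷_; [_]; _++_; map; filter; length; deduplicate; allFin)
open import Data.List.Extrema using (min)
open import Data.List.Membership.Propositional using (_∈_)
open import Data.List.Membership.Propositional.Properties using (∈-allFin)
open import Data.List.Relation.Unary.Any using (here; there)
open import Data.Nat using (ℕ; zero; suc; _≤_)
open import Data.Product using (Σ-syntax; _×_; _,_; proj₁; proj₂)
open import Data.Rational using (ℚ; _/_)
import Data.Rational as ℚ
import Data.Rational.Properties as ℚ
open import Data.Sum using (_⊎_; inj₁; inj₂)
open import Data.Vec using (tabulate; []; _∷_)
import Data.Vec.Properties as Vec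
open import Function using (_∘_)
open import Level using (0ℓ)
open import Relation.Binary using (Rel; Decidable; Symmetric; Irreflexive; TotalOrder)
import Relation.Binary.Construct.Add.Supremum.NonStrict as NonStrict
import Relation.Binary.Construct.Add.Supremum.Strict as Strict
open import Relation.Binary.Construct.Closure.ReflexiveTransitive using (Star; ε; _◅_; _◅◅_)
open import Relation.Binary.PropositionalEquality using (_≡_; _≢_; refl)
open import Relation.Nullary using (Dec; does; ¬_; ¬?)
open import Relation.Nullary.Construct.Add.Supremum as Sup using (_⁺; ⊤⁺)
open import Relation.Nullary.Decidable using (map′; _×-dec_; _⊎-dec_; _→-dec_)

record Graph (n : ℕ) : Set₁ where
  field
    Adj        : Rel (Fin n) 0ℓ
    adj?       : Decidable Adj
    adj-sym    : Symmetric Adj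
    adj-irrefl : Irreflexive _≡_ Adj

open Graph public

private
  variable
    n : ℕ

deleteEdge : Graph n → Fin n → Fin n → Graph n
deleteEdge G u v = record
  { Adj        = λ x y → Adj G x y × ¬ Ends x y
  ; adj?       = λ x y → adj? G x y ×-dec
               ¬? (((x Fin.≟ u) ×-dec (y Fin.≟ v)) ⊎-dec
                   ((x Fin.≟ v) ×-dec (y Fin.≟ u)))
  ; adj-sym    = λ (a , ¬e) → adj-sym G a , ¬e ∘ swapEnds
  ; adj-irrefl = λ x≡y → adj-irrefl G x≡y ∘ proj₁
  }
  where
  Ends : Rel (Fin _) 0ℓ
  Ends x y = (x ≡ u × y ≡ v) ⊎ (x ≡ v × y ≡ u)

  swapEnds : ∀ {x y} → Ends y x → Ends x y
  swapEnds (inj₁ (p , q)) = inj₂ (q , p)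
  swapEnds (inj₂ (p , q)) = inj₁ (q , p)

degree : Graph n → Fin n → ℕ
degree G v = ∣ tabulate (λ u → does (adj? G v u)) ∣

Complete : Graph n → Set
Complete G = ∀ u v → u ≢ v → Adj G u v

complete? : (G : Graph n) → Dec (Complete G)
complete? G = Fin.all? λ u → Fin.all? λ v → ¬? (u Fin.≟ v) →-dec adj? G u v

------------------------------------------------------------------------
-- Decidability of reachability, after Warshall: Via ws u v says that v is
-- reachable from u by a walk whose interior vertices all lie in ws.

module Reachability {R : Rel (Fin n) 0ℓ} (R? : Decidable R) where

  Via : List (Fin n) → Rel (Fin n) 0ℓ
  Via []       u v = u ≡ v ⊎ R u v
  Via (w ∷ ws) u v = Via ws u v ⊎ (Via ws u w × Via ws w v)

  via? : ∀ ws → Decidable (Via ws)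
  via? []       u v = (u Fin.≟ v) ⊎-dec R? u v
  via? (w ∷ ws) u v = via? ws u v ⊎-dec (via? ws u w ×-dec via? ws w v)

  via⇒star : ∀ ws {u v} → Via ws u v → Star R u v
  via⇒star []       (inj₁ refl)    = ε
  via⇒star []       (inj₂ r)       = r ◅ ε
  via⇒star (w ∷ ws) (inj₁ p)       = via⇒star ws p
  via⇒star (w ∷ ws) (inj₂ (p , q)) = via⇒star ws p ◅◅ via⇒star ws q

  step : ∀ ws {u v} → u ≡ v ⊎ R u v → Via ws u v
  step []       r = r
  step (w ∷ ws) r = inj₁ (step ws r)

  compose : ∀ ws {u v w} → w ∈ ws → Via ws u w → Via ws w v → Via ws u v
  compose (w ∷ ws) (here refl) p q = inj₂ (fromFirst p , toLast q)
    where
    fromFirst : ∀ {u} → Via (w ∷ ws) u w → Via ws u w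
    fromFirst (inj₁ p)       = p
    fromFirst (inj₂ (p , _)) = p

    toLast : ∀ {v} → Via (w ∷ ws) w v → Via ws w v
    toLast (inj₁ q)       = q
    toLast (inj₂ (_ , q)) = q
  compose (x ∷ ws) (there i) (inj₁ p)       (inj₁ q)         = inj₁ (compose ws i p q)
  compose (x ∷ ws) (there i) (inj₁ p)       (inj₂ (q , q′))  = inj₂ (compose ws i p q , q′)
  compose (x ∷ ws) (there i) (inj₂ (p , p′)) (inj₁ q)        = inj₂ (p , compose ws i p′ q)
  compose (x ∷ ws) (there i) (inj₂ (p , _)) (inj₂ (_ , q))   = inj₂ (p , q)

  star⇒via : ∀ {u v} → Star R u v → Via (allFin n) u v
  star⇒via ε        = step (allFin n) (inj₁ refl)
  star⇒via (r ◅ rs) = compose (allFin n) (∈-allFin _) (step (allFin n) (inj₂ r)) (star⇒via rs)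

  star? : Decidable (Star R)
  star? u v = map′ (via⇒star (allFin n)) star⇒via (via? (allFin n) u v)

------------------------------------------------------------------------

AdjOutside : Graph n → Subset n → Rel (Fin n) 0ℓ
AdjOutside G S u v = u ∉ S × v ∉ S × Adj G u v

adjOutside? : (G : Graph n) (S : Subset n) → Decidable (AdjOutside G S)
adjOutside? G S u v = ¬? (u ∈? S) ×-dec ¬? (v ∈? S) ×-dec adj? G u v

-- For u and v outside S: u and v lie in the same component of G − S.
ConnectedOutside : Graph n → Subset n → Rel (Fin n) 0ℓ
ConnectedOutside G S = Star (AdjOutside G S)

connectedOutside? : (G : Graph n) (S : Subset n) → Decidable (ConnectedOutside G S)
connectedOutside? G S = Reachability.star? (adjOutside? G S)

component : Graph n → Subset n → Fin n → Subset n
component G S v = tabulate (λ u → does (connectedOutside? G S v u))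

-- The distinct vertex sets of the components of G − S.
components : Graph n → Subset n → List (Subset n)
components {n} G S =
  deduplicate (Vec.≡-dec Bool._≟_)
    (map (component G S) (filter (λ v → ¬? (v ∈? S)) (allFin n)))

w : Graph n → Subset n → ℕ
w G S = length (components G S)

------------------------------------------------------------------------
-- Toughness takes values in ℚ with a top element ⊤⁺ = +∞ added.

open NonStrict ℚ._≤_ using (_≤⁺_; ≤⁺-isTotalOrder-≡)
open Strict ℚ._<_ using (_<⁺_) public

ℚ⁺-totalOrder : TotalOrder 0ℓ 0ℓ 0ℓ
ℚ⁺-totalOrder = record
  { Carrier      = ℚ ⁺
  ; _≈_          = _≡_
  ; _≤_          = _≤⁺_
  ; isTotalOrder = ≤⁺-isTotalOrder-≡ ℚ.≤-isTotalOrder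
  }

-- s / k for k ≥ 2.  The sets S with w (G − S) ≤ 1 do not enter the minimum
-- defining toughness; giving them the value +∞ has the same effect.
ratio : ℕ → ℕ → ℚ ⁺
ratio s zero            = ⊤⁺
ratio s (suc zero)      = ⊤⁺
ratio s k@(suc (suc _)) = Sup.[ + s / k ]

subsets : ∀ n → List (Subset n)
subsets zero    = [ [] ]
subsets (suc n) = map (inside ∷_) (subsets n) ++ map (outside ∷_) (subsets n)

-- In a noncomplete graph some S has w (G − S) ≥ 2 (all vertices but two
-- nonadjacent ones), so the default value of min is never attained there.
toughness : Graph n → ℚ ⁺
toughness {n} G =
  if does (complete? G)
  then ⊤⁺
  else min ℚ⁺-totalOrder ⊤⁺ (map (λ S → ratio ∣ S ∣ (w G S)) (subsets n))

MinimallyTough : ℚ ⁺ → Graph n → Set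
MinimallyTough t G =
  toughness G ≡ t ×
  (∀ u v → Adj G u v → toughness (deleteEdge G u v) <⁺ t)

------------------------------------------------------------------------

-- A cycle v₀ v₁ … v_m v₀ on m + 1 ≥ 3 distinct vertices.
record Cycle (G : Graph n) : Set where
  field
    m        : ℕ
    2≤m      : 2 ≤ m
    vertex   : Fin (suc m) → Fin n
    distinct : ∀ {i j} → vertex i ≡ vertex j → i ≡ j
    edge     : ∀ i → Adj G (vertex (inject₁ i)) (vertex (suc i))
    closing  : Adj G (vertex (fromℕ m)) (vertex zero)

cycleLength : {G : Graph n} → Cycle G → ℕ
cycleLength C = suc (Cycle.m C)

HasGirth : Graph n → ℕ → Set
HasGirth G g =
  (Σ[ C ∈ Cycle G ] cycleLength C ≡ g) ×
  (∀ (C : Cycle G) → g ≤ cycleLength C)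

-- Suppose every degree is at least d with 4d ≥ n + 7; G is triangle-free.  For each edge uv there is S
-- such that G − uv − S has more than |S| components and uv joins two of them.  A component with an
-- edge has at least 2d − 2 − |S| vertices, so two of these would not fit into n vertices; hence,
-- up to swapping u and v, u is isolated, v lies in the only nontrivial component, and the set I
-- of isolated vertices satisfies |I| ≥ |S| and N(I) ⊆ S apart from uv.  Call (S, I) a barrier.
--
-- Fix one barrier (S, I) and let I₀ = I − u.  Double counting the edges between I₀ and S yields s ∈ S
-- with at least d − 1 neighbours in I₀; let x be one of them.  Uncrossing (S, I₀) with a barrier (S′, I′)
-- of the edge xs, where 1-toughness gives |J| ≤ |N(J)| for independent J, contradicts |S| ≤ 2d − 5.
module Submission where

open import Defs
open import Data.Bool using (Bool; true; false; if_then_else_)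
import Data.Bool.Properties as Bool
open import Data.Empty using (⊥; ⊥-elim)
open import Data.Fin using (Fin; zero; suc)
import Data.Fin.Properties as Fin
open import Data.Fin.Subset using (Subset; inside; outside; ∣_∣; _∈_; _∉_)
open import Data.Fin.Subset.Properties using (_∈?_)
import Data.Integer as ℤ
import Data.Integer.Properties as ℤ
open import Data.List as List using (List; []; _∷_; map; filter; length; _++_; allFin)
open import Data.List.Extrema ℚ⁺-totalOrder using (min≤xs; argmin-sel)
import Data.List.Membership.Propositional as List
open import Data.List.Membership.Propositional.Properties
  using (∈-∃++; ∈-++⁺ˡ; ∈-++⁺ʳ; ∈-++⁻; ∈-map⁺; ∈-map⁻; ∈-filter⁺; ∈-filter⁻; ∈-allFin; ∈-deduplicate⁺; ∈-deduplicate⁻)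
open import Data.List.Properties using (length-map; length-++; length-++-sucʳ; map-cong)
open import Data.List.Relation.Binary.Subset.Propositional using (_⊆_)
import Data.List.Relation.Unary.All as All
import Data.List.Relation.Unary.AllPairs as AllPairs
open import Data.List.Relation.Unary.Any using (here; there)
open import Data.List.Relation.Unary.Unique.DecPropositional.Properties using (deduplicate-!)
open import Data.List.Relation.Unary.Unique.Propositional using (Unique)
open import Data.List.Relation.Unary.Unique.Propositional.Properties using (filter⁺; allFin⁺)
open import Data.Nat using (ℕ; zero; suc; _+_; _*_; _≤_; _<_; z≤n; s≤s; s≤s⁻¹)
open import Data.Nat.DivMod using (_/_; _%_; m%n<n; m≡m%n+[m/n]*n; m<n*o⇒m/o<n)
import Data.Nat.Properties as ℕ
open import Data.Nat.Tactic.RingSolver using (solve)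
open import Data.Product using (_×_; _,_; proj₁; proj₂; ∃-syntax)
open import Data.Rational as ℚ using (ℚ; 1ℚ)
import Data.Rational.Properties as ℚ
import Data.Rational.Unnormalised as ℚᵘ
import Data.Rational.Unnormalised.Properties as ℚᵘ
open import Data.Sum as Sum using (_⊎_; inj₁; inj₂; [_,_]′)
open import Data.Vec as Vec using (tabulate)
import Data.Vec.Properties as Vec
open import Function using (_∘_; id)
open import Function.Bundles using (_⇔_; mk⇔)
open import Relation.Binary using (TotalOrder)
import Relation.Binary.Construct.Add.Supremum.NonStrict as NonStrict
import Relation.Binary.Construct.Add.Supremum.Strict as Strict
open import Relation.Binary.Construct.Closure.ReflexiveTransitive using (ε; _◅_; _◅◅_; reverse; kleisliStar)
open import Relation.Binary.PropositionalEquality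
  using (_≡_; _≢_; refl; sym; trans; cong; cong₂; subst; subst₂)
open import Relation.Nullary using (Dec; yes; no; does; ¬_; ¬?; contradiction)
open import Relation.Nullary.Construct.Add.Supremum using ([_]; ⊤⁺; _⁺)
open import Relation.Nullary.Decidable using (_×-dec_; _⊎-dec_; dec-true; does-⇔)
open import Algebra.Properties.Semiring.Sum ℕ.+-*-semiring
  using (sum; sum-syntax; ∑-distrib-+; ∑-comm; sum-cong-≗; sum-replicate-zero; *-distribʳ-sum)

private
  variable
    n : ℕ
    A B : Set

-- Decidable sets of vertices and their cardinalities

sum-mono : {f g : Fin n → ℕ} → (∀ i → f i ≤ g i) → sum f ≤ sum g
sum-mono {zero}  f≤g = z≤n
sum-mono {suc n} f≤g = ℕ.+-mono-≤ (f≤g zero) (sum-mono (f≤g ∘ suc))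

ind : Bool → ℕ
ind b = if b then 1 else 0

-- Predicates rather than `Subset`: membership in unions, intersections and differences unfolds to
-- sums, products and negations, and cardinality, a sum of 0/1 values, can be compared vertex by
-- vertex.
record DecSet (n : ℕ) : Set₁ where
  field
    Mem  : Fin n → Set
    mem? : ∀ i → Dec (Mem i)

  at : Fin n → ℕ
  at i = ind (does (mem? i))

  # : ℕ
  # = sum at

open DecSet public

infixr 7 _∩_
infixr 6 _∪_
_∩_ _∪_ _∖_ : DecSet n → DecSet n → DecSet n
X ∩ Y = record { Mem = λ i → Mem X i × Mem Y i ; mem? = λ i → mem? X i ×-dec mem? Y i }
X ∪ Y = record { Mem = λ i → Mem X i ⊎ Mem Y i ; mem? = λ i → mem? X i ⊎-dec mem? Y i }
X ∖ Y = record { Mem = λ i → Mem X i × ¬ Mem Y i ; mem? = λ i → mem? X i ×-dec ¬? (mem? Y i) }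

∁ : DecSet n → DecSet n
∁ X = record { Mem = λ i → ¬ Mem X i ; mem? = λ i → ¬? (mem? X i) }

⁅_⁆ : Fin n → DecSet n
⁅ v ⁆ = record { Mem = _≡ v ; mem? = Fin._≟ v }

⟦_⟧ : Subset n → DecSet n
⟦ S ⟧ = record { Mem = _∈ S ; mem? = _∈? S }

toSubset : DecSet n → Subset n
toSubset X = tabulate (does ∘ mem? X)

N : Graph n → Fin n → DecSet n
N G v = record { Mem = Adj G v ; mem? = adj? G v }

countAt : List (DecSet n) → Fin n → ℕ
countAt []       i = 0
countAt (X ∷ Xs) i = at X i + countAt Xs i

total : List (DecSet n) → ℕ
total []       = 0
total (X ∷ Xs) = # X + total Xs

sum-countAt : (Xs : List (DecSet n)) → sum (countAt Xs) ≡ total Xs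
sum-countAt {n} []     = sum-replicate-zero n
sum-countAt (X ∷ Xs)   = trans (∑-distrib-+ (at X) (countAt Xs)) (cong (# X +_) (sum-countAt Xs))

-- Summing over the vertices reduces an inequality between sums of cardinalities to a case split on
-- the membership of a single vertex. The estimates for unions, disjoint sets and uncrossings all
-- come from this.
total-mono : (Xs Ys : List (DecSet n)) → (∀ i → countAt Xs i ≤ countAt Ys i) → total Xs ≤ total Ys
total-mono Xs Ys p = subst₂ _≤_ (sum-countAt Xs) (sum-countAt Ys) (sum-mono p)

#-singleton : (v : Fin n) → # ⁅ v ⁆ ≡ 1
#-singleton {suc n} zero = cong suc (sum-replicate-zero n)
#-singleton {suc n} (suc v) = trans (sum-cong-≗ λ i → cong ind (shift i)) (#-singleton v)
  where
  shift : ∀ i → does (suc i Fin.≟ suc v) ≡ does (i Fin.≟ v)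
  shift i with i Fin.≟ v
  ... | yes _ = refl
  ... | no  _ = refl

#-≤n : (X : DecSet n) → # X ≤ n
#-≤n {zero}  X = z≤n
#-≤n {suc n} X = ℕ.+-mono-≤ (ind≤1 (does (mem? X zero)))
                            (#-≤n record { Mem = Mem X ∘ suc ; mem? = mem? X ∘ suc })
  where
  ind≤1 : ∀ b → ind b ≤ 1
  ind≤1 true  = ℕ.≤-refl
  ind≤1 false = z≤n

#-mono : (X Y : DecSet n) → (∀ {i} → Mem X i → Mem Y i) → # X ≤ # Y
#-mono X Y X⊆Y = sum-mono pointwise
  where
  pointwise : ∀ i → at X i ≤ at Y i
  pointwise i with mem? X i | mem? Y i
  ... | no  _   | _       = z≤n
  ... | yes _   | yes _   = ℕ.≤-refl
  ... | yes i∈X | no  i∉Y = contradiction (X⊆Y i∈X) i∉Y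

#-disjoint : (X Y Z : DecSet n) → (∀ {i} → Mem X i → Mem Z i) → (∀ {i} → Mem Y i → Mem Z i) →
  (∀ {i} → Mem X i → ¬ Mem Y i) → # X + # Y ≤ # Z
#-disjoint X Y Z X⊆Z Y⊆Z X∩Y=∅ =
  subst₂ _≤_ (cong (# X +_) (ℕ.+-identityʳ _)) (ℕ.+-identityʳ _) (total-mono (X ∷ Y ∷ []) (Z ∷ []) pointwise)
  where
  pointwise : ∀ i → countAt (X ∷ Y ∷ []) i ≤ countAt (Z ∷ []) i
  pointwise i with mem? X i | mem? Y i | mem? Z i
  ... | no  _   | no  _   | _      = z≤n
  ... | yes i∈X | yes i∈Y | _      = contradiction i∈Y (X∩Y=∅ i∈X)
  ... | yes i∈X | no  _   | no i∉Z = contradiction (X⊆Z i∈X) i∉Z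
  ... | no  _   | yes i∈Y | no i∉Z = contradiction (Y⊆Z i∈Y) i∉Z
  ... | yes _   | no  _   | yes _  = ℕ.≤-refl
  ... | no  _   | yes _   | yes _  = ℕ.≤-refl

#-∪ : (X Y : DecSet n) → # (X ∪ Y) ≤ # X + # Y
#-∪ X Y = subst₂ _≤_ (ℕ.+-identityʳ _) (cong (# X +_) (ℕ.+-identityʳ _)) (total-mono (X ∪ Y ∷ []) (X ∷ Y ∷ []) pointwise)
  where
  pointwise : ∀ i → countAt (X ∪ Y ∷ []) i ≤ countAt (X ∷ Y ∷ []) i
  pointwise i with mem? X i | mem? Y i
  ... | no  _ | no  _ = z≤n
  ... | no  _ | yes _ = ℕ.≤-refl
  ... | yes _ | _     = s≤s z≤n

#≤1+# : (X Y : DecSet n) (v : Fin n) → (∀ {i} → Mem X i → i ≡ v ⊎ Mem Y i) → # X ≤ 1 + # Y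
#≤1+# X Y v X⊆ = ℕ.≤-trans (#-mono X (⁅ v ⁆ ∪ Y) X⊆)
  (ℕ.≤-trans (#-∪ ⁅ v ⁆ Y) (ℕ.≤-reflexive (cong (_+ # Y) (#-singleton v))))

#+#≤1+# : (X Y Z : DecSet n) (v : Fin n) → (∀ {i} → Mem X i → Mem Z i) → (∀ {i} → Mem Y i → Mem Z i) →
  (∀ {i} → Mem X i → Mem Y i → i ≡ v) → # X + # Y ≤ 1 + # Z
#+#≤1+# X Y Z v X⊆Z Y⊆Z X∩Y⊆v =
  subst₂ _≤_ (cong (# X +_) (ℕ.+-identityʳ _)) (cong₂ _+_ (#-singleton v) (ℕ.+-identityʳ _))
    (total-mono (X ∷ Y ∷ []) (⁅ v ⁆ ∷ Z ∷ []) pointwise)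
  where
  pointwise : ∀ i → countAt (X ∷ Y ∷ []) i ≤ countAt (⁅ v ⁆ ∷ Z ∷ []) i
  pointwise i with mem? X i | mem? Y i | mem? Z i | i Fin.≟ v
  ... | no  _   | no  _   | _      | _       = z≤n
  ... | yes i∈X | _       | no i∉Z | _       = contradiction (X⊆Z i∈X) i∉Z
  ... | _       | yes i∈Y | no i∉Z | _       = contradiction (Y⊆Z i∈Y) i∉Z
  ... | yes i∈X | yes i∈Y | _      | no  i≢v = contradiction (X∩Y⊆v i∈X i∈Y) i≢v
  ... | yes _   | yes _   | yes _  | yes _   = ℕ.≤-refl
  ... | yes _   | no  _   | yes _  | yes _   = s≤s z≤n
  ... | yes _   | no  _   | yes _  | no  _   = ℕ.≤-refl
  ... | no  _   | yes _   | yes _  | yes _   = s≤s z≤n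
  ... | no  _   | yes _   | yes _  | no  _   = ℕ.≤-refl

∣tabulate∣ : (f : Fin n → Bool) → ∣ tabulate f ∣ ≡ sum (ind ∘ f)
∣tabulate∣ {zero}  f = refl
∣tabulate∣ {suc n} f with f zero
... | true  = cong suc (∣tabulate∣ (f ∘ suc))
... | false = ∣tabulate∣ (f ∘ suc)

#-⟦⟧ : (S : Subset n) → # ⟦ S ⟧ ≡ ∣ S ∣
#-⟦⟧ Vec.[]            = refl
#-⟦⟧ (inside  Vec.∷ S) = cong suc (#-⟦⟧ S)
#-⟦⟧ (outside Vec.∷ S) = #-⟦⟧ S

#>0⇒nonempty : (X : DecSet n) → 1 ≤ # X → ∃[ i ] Mem X i
#>0⇒nonempty {suc n} X 1≤ with mem? X zero
... | yes x = zero , x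
... | no  _ with i , x ← #>0⇒nonempty record { Mem = Mem X ∘ suc ; mem? = mem? X ∘ suc } 1≤ = suc i , x

∈⇒#>0 : (X : DecSet n) → ∀ {i} → Mem X i → 1 ≤ # X
∈⇒#>0 X {i} i∈X = subst (_≤ # X) (#-singleton i) (#-mono ⁅ i ⁆ X λ { refl → i∈X })

∈-toSubset⁺ : (X : DecSet n) → ∀ {i} → Mem X i → i ∈ toSubset X
∈-toSubset⁺ X {i} x = Vec.lookup⇒[]= i _
  (trans (Vec.lookup∘tabulate (does ∘ mem? X) i) (dec-true (mem? X i) x))

∈-toSubset⁻ : (X : DecSet n) → ∀ {i} → i ∈ toSubset X → Mem X i
∈-toSubset⁻ X {i} i∈ with mem? X i | trans (sym (Vec.lookup∘tabulate (does ∘ mem? X) i)) (Vec.[]=⇒lookup i∈)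
... | yes x | _ = x
... | no  _ | ()

members : DecSet n → List (Fin n)
members X = filter (mem? X) (allFin _)

length-members : (X : DecSet n) → length (members X) ≡ # X
length-members X = go (mem? X) id
  where
  go : ∀ {m k} {P : Fin m → Set} (P? : ∀ i → Dec (P i)) (f : Fin k → Fin m) →
       length (filter P? (List.tabulate f)) ≡ ∑[ i < k ] ind (does (P? (f i)))
  go {k = zero}  P? f = refl
  go {k = suc k} P? f with does (P? (f zero))
  ... | true  = cong suc (go P? (f ∘ suc))
  ... | false = go P? (f ∘ suc)

Unique-⊆⇒length≤ : {xs ys : List A} → Unique xs → xs ⊆ ys → length xs ≤ length ys
Unique-⊆⇒length≤ AllPairs.[] xs⊆ys = z≤n
Unique-⊆⇒length≤ {xs = x ∷ xs} (x≢xs AllPairs.∷ xs!) xs⊆ys with as , bs , refl ← ∈-∃++ (xs⊆ys (here refl)) =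
  ℕ.≤-trans (s≤s (Unique-⊆⇒length≤ xs! xs⊆)) (ℕ.≤-reflexive (sym (length-++-sucʳ as x bs)))
  where
  xs⊆ : xs ⊆ as ++ bs
  xs⊆ y∈xs with ∈-++⁻ as (xs⊆ys (there y∈xs))
  ... | inj₁ y∈as         = ∈-++⁺ˡ y∈as
  ... | inj₂ (here refl)  = contradiction refl (All.lookup x≢xs y∈xs)
  ... | inj₂ (there y∈bs) = ∈-++⁺ʳ as y∈bs

Unique-map : (f : A → B) {xs : List A} → (∀ {x y} → x List.∈ xs → y List.∈ xs → f x ≡ f y → x ≡ y) →
             Unique xs → Unique (map f xs)
Unique-map f inj AllPairs.[] = AllPairs.[]
Unique-map f {x ∷ xs} inj (x≢xs AllPairs.∷ xs!) =
  All.tabulate (λ fy∈ fx≡ → let y , y∈xs , eq = ∈-map⁻ f fy∈ in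
    All.lookup x≢xs y∈xs (inj (here refl) (there y∈xs) (trans fx≡ eq)))
  AllPairs.∷ Unique-map f (λ x∈ y∈ → inj (there x∈) (there y∈)) xs!

-- Components and toughness

subsets-complete : (S : Subset n) → S List.∈ subsets n
subsets-complete Vec.[]            = here refl
subsets-complete (inside  Vec.∷ S) = ∈-++⁺ˡ (∈-map⁺ (inside Vec.∷_) (subsets-complete S))
subsets-complete (outside Vec.∷ S) = ∈-++⁺ʳ _ (∈-map⁺ (outside Vec.∷_) (subsets-complete S))

ratios : Graph n → List (ℚ ⁺)
ratios G = map (λ S → ratio ∣ S ∣ (w G S)) (subsets _)

1≤s/k⇒k≤s : ∀ s k → 1ℚ ℚ.≤ (ℤ.+ s ℚ./ suc k) → suc k ≤ s
1≤s/k⇒k≤s s k 1≤ with ℚᵘ.≤-respʳ-≃ (ℚ.toℚᵘ-fromℚᵘ (ℚᵘ.mkℚᵘ (ℤ.+ s) k)) (ℚ.toℚᵘ-mono-≤ 1≤)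
... | ℚᵘ.*≤* p = ℤ.drop‿+≤+ (subst₂ ℤ._≤_ (ℤ.*-identityˡ (ℤ.+ suc k)) (ℤ.*-identityʳ (ℤ.+ s)) p)

s/k<1⇒s<k : ∀ s k → (ℤ.+ s ℚ./ suc k) ℚ.< 1ℚ → s < suc k
s/k<1⇒s<k s k <1 with ℚᵘ.<-respˡ-≃ (ℚ.toℚᵘ-fromℚᵘ (ℚᵘ.mkℚᵘ (ℤ.+ s) k)) (ℚ.toℚᵘ-mono-< <1)
... | ℚᵘ.*<* p = ℤ.drop‿+<+ (subst₂ ℤ._<_ (ℤ.*-identityʳ (ℤ.+ s)) (ℤ.*-identityˡ (ℤ.+ suc k)) p)

-- The minimum is at most each entry of its list, which runs over all subsets; toughness 1 excludes
-- the complete case, whose value is `⊤⁺`.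
w≤∣S∣ : (G : Graph n) → toughness G ≡ [ 1ℚ ] → ∀ S → 2 ≤ w G S → w G S ≤ ∣ S ∣
w≤∣S∣ G τ≡1 S 2≤w = ratio≥1 (w G S) 2≤w (subst (_≤⁺ ratio ∣ S ∣ (w G S)) (noncomplete (does (complete? G)) τ≡1)
  (All.lookup (min≤xs ⊤⁺ (ratios G)) (∈-map⁺ (λ S → ratio ∣ S ∣ (w G S)) (subsets-complete S))))
  where
  open TotalOrder ℚ⁺-totalOrder using () renaming (_≤_ to _≤⁺_)

  noncomplete : ∀ b {m} → (if b then ⊤⁺ else m) ≡ [ 1ℚ ] → m ≡ [ 1ℚ ]
  noncomplete false eq = eq

  ratio≥1 : ∀ k → 2 ≤ k → [ 1ℚ ] ≤⁺ ratio ∣ S ∣ k → k ≤ ∣ S ∣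
  ratio≥1 (suc zero) (s≤s ()) _
  ratio≥1 (suc (suc k)) _ NonStrict.[ 1≤ ] = 1≤s/k⇒k≤s ∣ S ∣ (suc k) 1≤

-- The minimum is either the default `⊤⁺`, which is not below 1, or attained at some `S`. Since
-- `ratio` is `⊤⁺` for fewer than two components, this `S` leaves at least two.
∣S∣<w : (G : Graph n) → toughness G <⁺ [ 1ℚ ] → ∃[ S ] (2 ≤ w G S × ∣ S ∣ < w G S)
∣S∣<w G τ<1 with does (complete? G)
... | false with argmin-sel id ⊤⁺ (ratios G)
...   | inj₁ eq = contradiction (subst (_<⁺ [ 1ℚ ]) eq τ<1) λ ()
...   | inj₂ m∈ with S , _ , eq ← ∈-map⁻ (λ S → ratio ∣ S ∣ (w G S)) m∈ =
  S , ratio<1 (w G S) (subst (_<⁺ [ 1ℚ ]) eq τ<1)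
  where
  ratio<1 : ∀ k → ratio ∣ S ∣ k <⁺ [ 1ℚ ] → 2 ≤ k × ∣ S ∣ < k
  ratio<1 zero ()
  ratio<1 (suc zero) ()
  ratio<1 (suc (suc k)) Strict.[ <1 ] = s≤s (s≤s z≤n) , s/k<1⇒s<k ∣ S ∣ (suc k) <1

component-cong : (G H : Graph n) (S : Subset n) {u v : Fin n} →
  (∀ {x} → ConnectedOutside G S u x ⇔ ConnectedOutside H S v x) →
  component G S u ≡ component H S v
component-cong G H S {u} {v} iff = Vec.tabulate-cong λ x →
  does-⇔ iff (connectedOutside? G S u x) (connectedOutside? H S v x)

∈-component⁻ : (G : Graph n) (S : Subset n) {u v : Fin n} → v ∈ component G S u → ConnectedOutside G S u v
∈-component⁻ G S {u} = ∈-toSubset⁻ record { Mem = ConnectedOutside G S u ; mem? = connectedOutside? G S u }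

∈-component⁺ : (G : Graph n) (S : Subset n) {u v : Fin n} → ConnectedOutside G S u v → v ∈ component G S u
∈-component⁺ G S {u} = ∈-toSubset⁺ record { Mem = ConnectedOutside G S u ; mem? = connectedOutside? G S u }

connected-sym : (G : Graph n) (S : Subset n) {u v : Fin n} → ConnectedOutside G S u v → ConnectedOutside G S v u
connected-sym G S = reverse λ (u∉ , v∉ , uv) → v∉ , u∉ , adj-sym G uv

-- Replacing each step of a walk in one graph by a walk in the other shows that reachability agrees,
-- so the component lists coincide even before deduplication.
w-cong : (G H : Graph n) (S : Subset n) →
  (∀ {u v} → AdjOutside G S u v → ConnectedOutside H S u v) →
  (∀ {u v} → AdjOutside H S u v → ConnectedOutside G S u v) → w G S ≡ w H S
w-cong G H S to from = cong (length ∘ List.deduplicate (Vec.≡-dec Bool._≟_))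
  (map-cong (λ u → component-cong G H S {u} {u} (mk⇔ (kleisliStar id to) (kleisliStar id from)))
    (filter (λ v → ¬? (v ∈? S)) (allFin _)))

-- The duplicate-free list of components is contained in `Cs` followed by the components of the
-- members of `X`. Below, `Cs` holds the nontrivial components and every other component is charged
-- to one of its vertices in `X`.
w≤ : (G : Graph n) (S : Subset n) (Cs : List (Subset n)) (X : DecSet n) →
  (∀ {a} → a ∉ S → component G S a List.∈ Cs ⊎ Mem X a) → w G S ≤ length Cs + # X
w≤ G S Cs X cover = ℕ.≤-trans
  (Unique-⊆⇒length≤ (deduplicate-! (Vec.≡-dec Bool._≟_) _) covered)
  (ℕ.≤-reflexive (trans (length-++ Cs) (cong (length Cs +_) (trans (length-map _ (members X)) (length-members X)))))
  where
  covered : components G S ⊆ Cs ++ map (component G S) (members X)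
  covered C∈ with a , a∈ , refl ← ∈-map⁻ _ (∈-deduplicate⁻ (Vec.≡-dec Bool._≟_) _ C∈)
    with cover (proj₂ (∈-filter⁻ (λ v → ¬? (v ∈? S)) {xs = allFin _} a∈))
  ... | inj₁ C∈Cs = ∈-++⁺ˡ C∈Cs
  ... | inj₂ a∈X  = ∈-++⁺ʳ Cs (∈-map⁺ _ (∈-filter⁺ (mem? X) (∈-allFin a) a∈X))

-- A walk starting at an isolated vertex is empty, so distinct members of `J` have distinct
-- components.
isolated⇒#≤w : (G : Graph n) (S : Subset n) (J : DecSet n) →
  (∀ {a} → Mem J a → a ∉ S) → (∀ {a b} → Mem J a → ¬ AdjOutside G S a b) → # J ≤ w G S
isolated⇒#≤w G S J J∩S=∅ isolated = ℕ.≤-trans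
  (ℕ.≤-reflexive (sym (trans (length-map (component G S) (members J)) (length-members J))))
  (Unique-⊆⇒length≤ (Unique-map (component G S) injective (filter⁺ (mem? J) (allFin⁺ _))) isComponent)
  where
  ∈J : ∀ {a} → a List.∈ members J → Mem J a
  ∈J a∈ = proj₂ (∈-filter⁻ (mem? J) {xs = allFin _} a∈)

  injective : ∀ {a b} → a List.∈ members J → b List.∈ members J → component G S a ≡ component G S b → a ≡ b
  injective {a} {b} a∈ _ eq with ∈-component⁻ G S (subst (b ∈_) (sym eq) (∈-component⁺ G S ε))
  ... | ε     = refl
  ... | e ◅ _ = contradiction e (isolated (∈J a∈))

  isComponent : map (component G S) (members J) ⊆ components G S
  isComponent C∈ with a , a∈ , refl ← ∈-map⁻ _ C∈ =
    ∈-deduplicate⁺ (Vec.≡-dec Bool._≟_) (∈-map⁺ _ (∈-filter⁺ (λ v → ¬? (v ∈? S)) (∈-allFin a) (J∩S=∅ (∈J a∈))))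

-- All vertices of `J` are isolated in `G − T`, so `# J ≤ w`. Toughness bounds `w` by `# T` once
-- `w ≥ 2`; if `w ≤ 1` and `J` is nonempty, a neighbour of a member of `J` shows that `T` is
-- nonempty.
independent⇒#≤ : (G : Graph n) → toughness G ≡ [ 1ℚ ] → (∀ v → 1 ≤ # (N G v)) → (J T : DecSet n) →
  (∀ {a} → Mem J a → ¬ Mem T a) → (∀ {a b} → Mem J a → Adj G a b → Mem T b) → # J ≤ # T
independent⇒#≤ G τ≡1 deg≥1 J T J∩T=∅ NJ⊆T
  with isolated⇒#≤w G (toSubset T) J (λ a∈J → J∩T=∅ a∈J ∘ ∈-toSubset⁻ T)
         (λ a∈J (_ , b∉ , ab) → b∉ (∈-toSubset⁺ T (NJ⊆T a∈J ab)))
     | 2 ℕ.≤? w G (toSubset T) | 1 ℕ.≤? # J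
... | _    | _       | no  #J≱1 = ℕ.≤-trans (s≤s⁻¹ (ℕ.≰⇒> #J≱1)) z≤n
... | #J≤w | yes 2≤w | yes _    = ℕ.≤-trans #J≤w
  (ℕ.≤-trans (w≤∣S∣ G τ≡1 _ 2≤w) (ℕ.≤-reflexive (∣tabulate∣ (does ∘ mem? T))))
... | #J≤w | no  2≰w | yes #J≥1
  with a , a∈J ← #>0⇒nonempty J #J≥1 with b , ab ← #>0⇒nonempty (N G a) (deg≥1 a) =
  ℕ.≤-trans #J≤w (ℕ.≤-trans (s≤s⁻¹ (ℕ.≰⇒> 2≰w)) (∈⇒#>0 T (NJ⊆T a∈J ab)))

-- Linear arithmetic

-- Here u ≤ v is a sum of hypotheses, and z is what both of its sides have in common.
≤-from-sum : ∀ z {u v x y} → u ≤ v → u ≡ z + x → v ≡ z + y → x ≤ y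
≤-from-sum z u≤v refl refl = ℕ.+-cancelˡ-≤ z _ _ u≤v

<-from-sum : ∀ z m {u v} → u ≤ v → u ≡ z + suc m → v ≡ z → ⊥
<-from-sum z m u≤v refl refl = ℕ.m+1+n≰m z u≤v

-- Here `i = # I₀`, `k = # S` and `d = 2 + c`. The first two hypotheses give `2k ≤ d`; with
-- `d ≤ k + 1` this forces `k ≤ 1` and `d ≤ 2`.
richVertex-arith : ∀ i k c → i * (2 + c) ≤ k * c → k ≤ 1 + i → 2 + c ≤ 1 + k → ¬ (k + 5 ≤ 2 * (2 + c))
richVertex-arith i k c p q r s = <-from-sum (3 * k + 3 * c + 9) 1
  (ℕ.+-mono-≤ k*2≤2+c (ℕ.+-mono-≤ (ℕ.+-mono-≤ r (ℕ.+-mono-≤ r r)) s))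
  (solve (k ∷ c ∷ [])) (solve (k ∷ c ∷ []))
  where
  open ℕ.≤-Reasoning
  k*2≤2+c : k * 2 ≤ 2 + c
  k*2≤2+c = ℕ.+-cancelʳ-≤ (k * c) _ _ (begin
    k * 2 + k * c         ≡⟨ ℕ.*-distribˡ-+ k 2 c ⟨
    k * (2 + c)           ≤⟨ ℕ.*-monoˡ-≤ (2 + c) q ⟩
    (2 + c) + i * (2 + c) ≤⟨ ℕ.+-monoʳ-≤ (2 + c) p ⟩
    (2 + c) + k * c       ∎)

-- Here `a = # (S′ ∩ S)`, `b = # (I′ ∩ I₀)`, `i = # I₀`, `k = # S` and `D = # (N G s ∩ I₀)`. After
-- cancellation `a + i ≤ b + k` remains, and the last two hypotheses are added to it.
case₁-arith : ∀ {a i t i′ b k j s′ D d} → j ≤ t → s′ ≤ i′ → a + (i + (t + (i′ + 0))) ≤ b + (k + (j + (s′ + 0))) →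
  b + D ≤ 1 + i → d ≤ 1 + a → D + d ≤ k + 2
case₁-arith {a} {i} {t} {i′} {b} {k} {j} {s′} {D} {d} p q r s u = ≤-from-sum (a + i + b + t + i′ + j + s′)
  (ℕ.+-mono-≤ p (ℕ.+-mono-≤ q (ℕ.+-mono-≤ r (ℕ.+-mono-≤ s u))))
  (solve (a ∷ i ∷ t ∷ i′ ∷ b ∷ k ∷ j ∷ s′ ∷ D ∷ d ∷ []))
  (solve (a ∷ i ∷ t ∷ i′ ∷ b ∷ k ∷ j ∷ s′ ∷ D ∷ d ∷ []))

case₁-absurd : ∀ {k D d} → d ≤ 1 + D → D + d ≤ k + 2 → ¬ (k + 5 ≤ 2 * d)
case₁-absurd {k} {D} {d} p q r = <-from-sum (k + D + 2 * d + 3) 1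
  (ℕ.+-mono-≤ p (ℕ.+-mono-≤ q r)) (solve (k ∷ D ∷ d ∷ [])) (solve (k ∷ D ∷ d ∷ []))

-- As before, but with `a = # (S′ ∩ I₀)`, `b = # (I′ ∩ S)` and `δ = # (N G x)`; again
-- `a + i ≤ b + k` remains.
case₂-arith : ∀ {a i t₁ t₂ i′ b k j₁ j₂ s′ D d δ} → j₁ ≤ t₁ → j₂ ≤ t₂ → s′ ≤ i′ →
  a + (i + (t₁ + (t₂ + (i′ + 0)))) ≤ b + (k + (j₁ + (j₂ + (s′ + 0)))) →
  D ≤ 1 + a → b + δ ≤ 1 + k → d ≤ δ → D + d + i ≤ k + k + 2
case₂-arith {a} {i} {t₁} {t₂} {i′} {b} {k} {j₁} {j₂} {s′} {D} {d} {δ} p₁ p₂ q r s u v =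
  ≤-from-sum (a + b + t₁ + t₂ + i′ + j₁ + j₂ + s′ + δ)
  (ℕ.+-mono-≤ p₁ (ℕ.+-mono-≤ p₂ (ℕ.+-mono-≤ q (ℕ.+-mono-≤ r (ℕ.+-mono-≤ s (ℕ.+-mono-≤ u v))))))
  (solve (a ∷ i ∷ t₁ ∷ t₂ ∷ i′ ∷ b ∷ k ∷ j₁ ∷ j₂ ∷ s′ ∷ D ∷ δ ∷ d ∷ []))
  (solve (a ∷ i ∷ t₁ ∷ t₂ ∷ i′ ∷ b ∷ k ∷ j₁ ∷ j₂ ∷ s′ ∷ D ∷ δ ∷ d ∷ []))

-- The first three hypotheses give `2d ≤ k + 4`, so the constant 5 in the size bound of a barrier is
-- exactly what this case requires.
case₂-absurd : ∀ {k D i d} → d ≤ 1 + D → k ≤ 1 + i → D + d + i ≤ k + k + 2 → ¬ (k + 5 ≤ 2 * d)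
case₂-absurd {k} {D} {i} {d} p q r s = <-from-sum (k + k + D + i + 2 * d + 4) 0
  (ℕ.+-mono-≤ p (ℕ.+-mono-≤ q (ℕ.+-mono-≤ r s))) (solve (k ∷ D ∷ i ∷ d ∷ [])) (solve (k ∷ D ∷ i ∷ d ∷ []))

-- The sizes `x`, `y`, `z` are those of the complement of `S` before, between and after the removal
-- of two components of sizes `a` and `a′`. Together the bounds give `4d ≤ n + 5`.
twoLarge-absurd : ∀ d {n k w a a′ x y z} → n + 7 ≤ 4 * d → suc k ≤ w → k + x ≤ n → a + y ≤ x → a′ + z ≤ y → w ≤ 2 + z →
  2 * d ≤ k + a + 2 → 2 * d ≤ k + a′ + 2 → ⊥
twoLarge-absurd d {n} {k} {w} {a} {a′} {x} {y} {z} p q r s t u A A′ =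
  <-from-sum (n + 4 * d + w + 2 * k + x + y + z + a + a′ + 6) 1
    (ℕ.+-mono-≤ p (ℕ.+-mono-≤ q (ℕ.+-mono-≤ r (ℕ.+-mono-≤ s (ℕ.+-mono-≤ t (ℕ.+-mono-≤ u (ℕ.+-mono-≤ A A′)))))))
    (solve (n ∷ d ∷ k ∷ w ∷ a ∷ a′ ∷ x ∷ y ∷ z ∷ [])) (solve (n ∷ d ∷ k ∷ w ∷ a ∷ a′ ∷ x ∷ y ∷ z ∷ []))

twoTrivial-absurd : ∀ d {n k w x} → n + 7 ≤ 4 * d → suc k ≤ w → k + x ≤ n → w ≤ x → 2 * d ≤ k + 2 → ⊥
twoTrivial-absurd d {n} {k} {w} {x} p q r s t =
  <-from-sum (n + 4 * d + w + 2 * k + x + 4) 3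
    (ℕ.+-mono-≤ p (ℕ.+-mono-≤ q (ℕ.+-mono-≤ r (ℕ.+-mono-≤ s (ℕ.+-mono-≤ t t)))))
    (solve (n ∷ d ∷ k ∷ w ∷ x ∷ [])) (solve (n ∷ d ∷ k ∷ w ∷ x ∷ []))

-- Counting vertices gives `2k + a ≤ n`, where `a` is the size of the nontrivial component;
-- inserting its lower bound yields `k + 2d ≤ n + 2 ≤ 4d − 5`.
oneTrivial-bound : ∀ d {n k w a x y} → n + 7 ≤ 4 * d → suc k ≤ w → k + x ≤ n → a + y ≤ x → w ≤ 1 + y →
  2 * d ≤ k + a + 2 → k + 5 ≤ 2 * d
oneTrivial-bound d {n} {k} {w} {a} {x} {y} p q r s t A =
  ≤-from-sum (n + 2 * d + w + k + x + y + a + 3)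
    (ℕ.+-mono-≤ p (ℕ.+-mono-≤ q (ℕ.+-mono-≤ r (ℕ.+-mono-≤ s (ℕ.+-mono-≤ t A)))))
    (solve (n ∷ d ∷ k ∷ w ∷ a ∷ x ∷ y ∷ [])) (solve (n ∷ d ∷ k ∷ w ∷ a ∷ x ∷ y ∷ []))

-- Barriers

-- The set S destroys 1-toughness once the edge pq is deleted, and p becomes isolated.
record Barrier {n} (G : Graph n) (d : ℕ) (p q : Fin n) : Set₁ where
  field
    S I      : DecSet n
    disjoint : ∀ {t} → Mem I t → ¬ Mem S t
    p∈I      : Mem I p
    q∉S      : ¬ Mem S q
    N⊆       : ∀ {t y} → Mem I t → Adj G t y → Mem S y ⊎ (t ≡ p × y ≡ q)
    #S≤#I    : # S ≤ # I
    #S+5≤2d  : # S + 5 ≤ 2 * d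

-- `H` is given by its relation to `G`, not as `deleteEdge G u v`, so that the same `H` and `T`
-- serve with `u` and `v` interchanged.
module Deletion {n} (G H : Graph n) (u v : Fin n)
  (H⊆G : ∀ {x y} → Adj H x y → Adj G x y)
  (G⊆H : ∀ {x y} → Adj G x y → Adj H x y ⊎ (x ≡ u × y ≡ v) ⊎ (x ≡ v × y ≡ u))
  (triangle-free : ∀ {a b c} → Adj G a b → Adj G b c → ¬ Adj G a c)
  (d : ℕ) (d≤deg : ∀ v → d ≤ # (N G v)) (n+7≤4d : n + 7 ≤ 4 * d)
  (T : Subset n) (#T<w : # ⟦ T ⟧ < w H T) (w≢w : w G T ≢ w H T)
  where

  private
    S : DecSet n
    S = ⟦ T ⟧

  Connected : Fin n → Fin n → Set
  Connected = ConnectedOutside H T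

  -- Otherwise every edge of `G − T` could be replaced by a walk in `H − T`, against `w≢w`. The form
  -- as an implication yields three facts at once: `u` and `v` avoid `T` and lie in different
  -- components.
  ¬bypass : ¬ (u ∉ T → v ∉ T → Connected u v)
  ¬bypass conn = w≢w (w-cong G H T to (λ (x∉ , y∉ , xy) → (x∉ , y∉ , H⊆G xy) ◅ ε))
    where
    to : ∀ {x y} → AdjOutside G T x y → Connected x y
    to (x∉ , y∉ , xy) with G⊆H xy
    ... | inj₁ xy′                  = (x∉ , y∉ , xy′) ◅ ε
    ... | inj₂ (inj₁ (refl , refl)) = conn x∉ y∉
    ... | inj₂ (inj₂ (refl , refl)) = connected-sym H T (conn y∉ x∉)

  u∉T : u ∉ T
  u∉T u∈T = ¬bypass λ u∉T → contradiction u∈T u∉T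

  v∉T : v ∉ T
  v∉T v∈T = ¬bypass λ _ v∉T → contradiction v∈T v∉T

  ¬connected : ¬ Connected u v
  ¬connected conn = ¬bypass λ _ _ → conn

  component-≡ : ∀ {a b} → Connected a b → component H T b ≡ component H T a
  component-≡ {a} {b} ab = component-cong H H T {b} {a} (mk⇔ (ab ◅◅_) (connected-sym H T ab ◅◅_))

  C : Fin n → DecSet n
  C a = record { Mem = Connected a ; mem? = connectedOutside? H T a }

  C∩T=∅ : ∀ {a y} → a ∉ T → Connected a y → y ∉ T
  C∩T=∅ a∉T ε                    = a∉T
  C∩T=∅ _   ((_ , b∉T , _) ◅ by) = C∩T=∅ b∉T by

  Nontrivial : Fin n → Set
  Nontrivial a = ∃[ b ] AdjOutside H T a b

  nontrivial? : ∀ a → Dec (Nontrivial a)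
  nontrivial? a = Fin.any? (adjOutside? H T a)

  ends : DecSet n
  ends = ⁅ u ⁆ ∪ ⁅ v ⁆

  #ends≤2 : # ends ≤ 2
  #ends≤2 = ℕ.≤-trans (#-∪ ⁅ u ⁆ ⁅ v ⁆) (ℕ.≤-reflexive (cong₂ _+_ (#-singleton u) (#-singleton v)))

  N⊆C : ∀ {a x y} → Connected a x → x ∉ T → Adj G x y → Mem ((S ∪ C a) ∪ ends) y
  N⊆C {y = y} ax x∉T xy with y ∈? T | G⊆H xy
  ... | yes y∈T | _                     = inj₁ (inj₁ y∈T)
  ... | no  y∉T | inj₁ xy′              = inj₁ (inj₂ (ax ◅◅ (x∉T , y∉T , xy′) ◅ ε))
  ... | no  _   | inj₂ (inj₁ (_ , y≡v)) = inj₂ (inj₂ y≡v)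
  ... | no  _   | inj₂ (inj₂ (_ , y≡u)) = inj₂ (inj₁ y≡u)

  2d≤ : ∀ {a b} → Adj G a b → (Z : DecSet n) → (∀ {y} → Adj G a y → Mem Z y) → (∀ {y} → Adj G b y → Mem Z y) → 2 * d ≤ # Z
  2d≤ {a} {b} ab Z Na⊆Z Nb⊆Z = ℕ.≤-trans
    (ℕ.+-mono-≤ (d≤deg a) (ℕ.≤-trans (ℕ.≤-reflexive (ℕ.+-identityʳ d)) (d≤deg b)))
    (#-disjoint (N G a) (N G b) Z Na⊆Z Nb⊆Z (λ ay by → triangle-free ab by ay))

  -- By triangle-freeness the ends of an edge in the component have disjoint neighbourhoods. These
  -- are taken in `G`, so they may also contain `u` and `v`, which accounts for the summand 2.
  nontrivial⇒large : ∀ {a} → Nontrivial a → 2 * d ≤ # S + # (C a) + 2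
  nontrivial⇒large {a} (b , ab@(a∉T , b∉T , ab′)) = ℕ.≤-trans
    (2d≤ (H⊆G ab′) ((S ∪ C a) ∪ ends) (N⊆C ε a∉T) (N⊆C (ab ◅ ε) b∉T))
    (ℕ.≤-trans (#-∪ (S ∪ C a) ends) (ℕ.+-mono-≤ (#-∪ S (C a)) #ends≤2))

  #S+#∁S≤n : # S + # (∁ S) ≤ n
  #S+#∁S≤n = ℕ.≤-trans (#-disjoint S (∁ S) (S ∪ ∁ S) inj₁ inj₂ (λ i∈S i∉S → i∉S i∈S)) (#-≤n (S ∪ ∁ S))

  #-∖ : (X Y : DecSet n) → (∀ {i} → Mem X i → Mem Y i) → # X + # (Y ∖ X) ≤ # Y
  #-∖ X Y X⊆Y = #-disjoint X (Y ∖ X) Y X⊆Y proj₁ (λ i∈X (_ , i∉X) → i∉X i∈X)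

  nontrivial⇒connected : ∀ {a b} → Nontrivial a → Nontrivial b → Connected a b
  nontrivial⇒connected {a} {b} a! b! with connectedOutside? H T a b
  ... | yes ab = ab
  -- Two large components and at least one vertex for each of the remaining components exceed `n`
  -- vertices.
  ... | no ¬ab = ⊥-elim (twoLarge-absurd d n+7≤4d #T<w #S+#∁S≤n
    (#-∖ (C a) (∁ S) (C∩T=∅ (proj₁ (proj₂ a!))))
    (#-∖ (C b) (∁ S ∖ C a) (λ by → C∩T=∅ (proj₁ (proj₂ b!)) by , λ ay → ¬ab (ay ◅◅ connected-sym H T by)))
    (w≤ H T (component H T a ∷ component H T b ∷ []) ((∁ S ∖ C a) ∖ C b) cover)
    (nontrivial⇒large a!) (nontrivial⇒large b!))
    where
    cover : ∀ {x} → x ∉ T → component H T x List.∈ (component H T a ∷ component H T b ∷ []) ⊎ Mem ((∁ S ∖ C a) ∖ C b) x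
    cover {x} x∉T with connectedOutside? H T a x | connectedOutside? H T b x
    ... | yes ax | _      = inj₁ (here (component-≡ ax))
    ... | no _   | yes bx = inj₁ (there (here (component-≡ bx)))
    ... | no ¬ax | no ¬bx = inj₂ ((x∉T , ¬ax) , ¬bx)

  ¬bothNontrivial : Nontrivial u → ¬ Nontrivial v
  ¬bothNontrivial u! v! = ¬connected (nontrivial⇒connected u! v!)

  -- If both ends were isolated, their disjoint neighbourhoods would lie in `S` and the two ends, so
  -- `2d ≤ # S + 2`; but `# S < w` and `# S + w ≤ n` keep `# S` below `n / 2`.
  ¬bothTrivial : Adj G u v → ¬ Nontrivial u → Nontrivial v
  ¬bothTrivial uv u-trivial with nontrivial? v
  ... | yes v!       = v!
  ... | no v-trivial = ⊥-elim (twoTrivial-absurd d n+7≤4d #T<w #S+#∁S≤n (w≤ H T [] (∁ S) inj₂)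
    (ℕ.≤-trans (2d≤ uv (S ∪ ends) (Na⊆ u∉T u-trivial) (Na⊆ v∉T v-trivial))
      (ℕ.≤-trans (#-∪ S ends) (ℕ.+-monoʳ-≤ (# S) #ends≤2))))
    where
    Na⊆ : ∀ {a y} → a ∉ T → ¬ Nontrivial a → Adj G a y → Mem (S ∪ ends) y
    Na⊆ {y = y} a∉T a-trivial ay with y ∈? T | G⊆H ay
    ... | yes y∈T | _                     = inj₁ y∈T
    ... | no  y∉T | inj₁ ay′              = contradiction (y , a∉T , y∉T , ay′) a-trivial
    ... | no  _   | inj₂ (inj₁ (_ , y≡v)) = inj₂ (inj₂ y≡v)
    ... | no  _   | inj₂ (inj₂ (_ , y≡u)) = inj₂ (inj₁ y≡u)

  trivial-barrier : ¬ Nontrivial u → Nontrivial v → Barrier G d u v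
  trivial-barrier u-trivial v! = record
    { S = S
    ; I = I
    ; disjoint = λ (t∉T , _) → t∉T
    ; p∈I = u∉T , u-trivial
    ; q∉S = v∉T
    ; N⊆ = NI⊆
    -- All nontrivial vertices lie in the component of `v`, so `w` is at most `1 + # I`; this 1 is
    -- absorbed by the strictness of `# S < w`.
    ; #S≤#I = s≤s⁻¹ (ℕ.≤-trans #T<w (w≤ H T (component H T v ∷ []) I cover-I))
    ; #S+5≤2d = oneTrivial-bound d n+7≤4d #T<w #S+#∁S≤n (#-∖ (C v) (∁ S) (C∩T=∅ v∉T))
        (w≤ H T (component H T v ∷ []) (∁ S ∖ C v) cover-rest) (nontrivial⇒large v!)
    }
    where
    I : DecSet n
    I = record { Mem  = λ a → a ∉ T × ¬ Nontrivial a
               ; mem? = λ a → ¬? (a ∈? T) ×-dec ¬? (nontrivial? a) }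

    NI⊆ : ∀ {t y} → Mem I t → Adj G t y → Mem S y ⊎ (t ≡ u × y ≡ v)
    NI⊆ {y = y} (t∉T , t-trivial) ty with y ∈? T | G⊆H ty
    ... | yes y∈T | _                     = inj₁ y∈T
    ... | no  y∉T | inj₁ ty′              = contradiction (y , t∉T , y∉T , ty′) t-trivial
    ... | no  _   | inj₂ (inj₁ uv)        = inj₂ uv
    ... | no  _   | inj₂ (inj₂ (refl , _)) = contradiction v! t-trivial

    cover-I : ∀ {x} → x ∉ T → component H T x List.∈ (component H T v ∷ []) ⊎ Mem I x
    cover-I {x} x∉T with nontrivial? x
    ... | yes x!       = inj₁ (here (component-≡ (nontrivial⇒connected v! x!)))
    ... | no x-trivial = inj₂ (x∉T , x-trivial)

    cover-rest : ∀ {x} → x ∉ T → component H T x List.∈ (component H T v ∷ []) ⊎ Mem (∁ S ∖ C v) x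
    cover-rest {x} x∉T with connectedOutside? H T v x
    ... | yes vx = inj₁ (here (component-≡ vx))
    ... | no ¬vx = inj₂ (x∉T , ¬vx)

barrier : (G : Graph n) → MinimallyTough [ 1ℚ ] G → (∀ {a b c} → Adj G a b → Adj G b c → ¬ Adj G a c) →
  (d : ℕ) → (∀ v → d ≤ # (N G v)) → n + 7 ≤ 4 * d → ∀ {u v} → Adj G u v → Barrier G d u v ⊎ Barrier G d v u
barrier G (τ≡1 , minimal) triangle-free d d≤deg n+7≤4d {u} {v} uv
  with T , 2≤w , ∣T∣<w ← ∣S∣<w (deleteEdge G u v) (minimal u v uv) = choose (D.nontrivial? u)
  where
  H : Graph _
  H = deleteEdge G u v

  G⊆H : ∀ {x y} → Adj G x y → Adj H x y ⊎ (x ≡ u × y ≡ v) ⊎ (x ≡ v × y ≡ u)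
  G⊆H {x} {y} xy with ((x Fin.≟ u) ×-dec (y Fin.≟ v)) ⊎-dec ((x Fin.≟ v) ×-dec (y Fin.≟ u))
  ... | yes e = inj₂ e
  ... | no ¬e = inj₁ (xy , ¬e)

  #T<w : # ⟦ T ⟧ < w H T
  #T<w = subst (_< w H T) (sym (#-⟦⟧ T)) ∣T∣<w

  w≢w : w G T ≢ w H T
  -- With equal counts, `G − T` too would have at least two components and more than `∣ T ∣` of
  -- them, against toughness 1.
  w≢w eq = ℕ.<⇒≱ ∣T∣<w (subst (_≤ ∣ T ∣) eq (w≤∣S∣ G τ≡1 T (subst (2 ≤_) (sym eq) 2≤w)))

  module D = Deletion G H u v proj₁ G⊆H triangle-free d d≤deg n+7≤4d T #T<w w≢w
  module D′ = Deletion G H v u proj₁ (Sum.map₂ Sum.swap ∘ G⊆H) triangle-free d d≤deg n+7≤4d T #T<w w≢w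

  choose : Dec (D.Nontrivial u) → Barrier G d u v ⊎ Barrier G d v u
  choose (no u-trivial) = inj₁ (D.trivial-barrier u-trivial (D.¬bothTrivial uv u-trivial))
  choose (yes u!)       = inj₂ (D′.trivial-barrier (D.¬bothNontrivial u!) u!)

-- Uncrossing two barriers

-- Both sides bound the number of adjacent pairs `(t , s)` with `t` in `X` and `s` in `S`, summed
-- first over `s` and then over `t`, or in the other order.
double-count : (G : Graph n) (X S : DecSet n) (c d : ℕ) →
  (∀ {s} → Mem S s → # (N G s ∩ X) ≤ c) → (∀ {t} → Mem X t → d ≤ # (N G t ∩ S)) → # X * d ≤ # S * c
double-count {n} G X S c d ≤c d≤ = begin
  # X * d                                             ≡⟨ *-distribʳ-sum d (at X) ⟩
  ∑[ t < n ] (at X t * d)                             ≤⟨ sum-mono lower ⟩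
  ∑[ t < n ] (# (N G t ∩ S) * at X t)                 ≡⟨ sum-cong-≗ (λ t → *-distribʳ-sum (at X t) (at (N G t ∩ S))) ⟩
  ∑[ t < n ] ∑[ s < n ] (at (N G t ∩ S) s * at X t)   ≡⟨ sum-cong-≗ (λ t → sum-cong-≗ (swap t)) ⟩
  ∑[ t < n ] ∑[ s < n ] (at (N G s ∩ X) t * at S s)   ≡⟨ ∑-comm (λ t s → at (N G s ∩ X) t * at S s) ⟩
  ∑[ s < n ] ∑[ t < n ] (at (N G s ∩ X) t * at S s)   ≡⟨ sum-cong-≗ (λ s → *-distribʳ-sum (at S s) (at (N G s ∩ X))) ⟨
  ∑[ s < n ] (# (N G s ∩ X) * at S s)                 ≤⟨ sum-mono upper ⟩
  ∑[ s < n ] (at S s * c)                             ≡⟨ *-distribʳ-sum c (at S) ⟨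
  # S * c                                             ∎
  where
  open ℕ.≤-Reasoning

  lower : ∀ t → at X t * d ≤ # (N G t ∩ S) * at X t
  lower t with mem? X t
  ... | no  _   = z≤n
  ... | yes t∈X = subst₂ _≤_ (sym (ℕ.*-identityˡ d)) (sym (ℕ.*-identityʳ _)) (d≤ t∈X)

  upper : ∀ s → # (N G s ∩ X) * at S s ≤ at S s * c
  upper s with mem? S s
  ... | no  _   = ℕ.≤-reflexive (ℕ.*-zeroʳ (# (N G s ∩ X)))
  ... | yes s∈S = subst₂ _≤_ (sym (ℕ.*-identityʳ _)) (sym (ℕ.*-identityˡ c)) (≤c s∈S)

  swap : ∀ t s → at (N G t ∩ S) s * at X t ≡ at (N G s ∩ X) t * at S s
  swap t s with adj? G t s | adj? G s t | mem? S s | mem? X t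
  ... | yes ts | no ¬st | _     | _     = contradiction (adj-sym G ts) ¬st
  ... | no ¬ts | yes st | _     | _     = contradiction (adj-sym G st) ¬ts
  ... | no  _  | no  _  | _     | _     = refl
  ... | yes _  | yes _  | yes _ | yes _ = refl
  ... | yes _  | yes _  | yes _ | no  _ = refl
  ... | yes _  | yes _  | no  _ | yes _ = refl
  ... | yes _  | yes _  | no  _ | no  _ = refl

-- The first members of both lists are what the uncrossing estimates; the pairs consisting of T and J,
-- or S′ and I′, cancel since |J| ≤ |T| and |S′| ≤ |I′|.
module _ (S I S′ I′ : DecSet n)
  (I∩S=∅ : ∀ {i} → Mem I i → ¬ Mem S i) (I′∩S′=∅ : ∀ {i} → Mem I′ i → ¬ Mem S′ i) where

  private
    R = ∁ (S ∪ I)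

  uncross₁ : total (S′ ∩ S ∷ I ∷ (S ∖ I′) ∪ (S′ ∩ R) ∷ I′ ∷ []) ≤ total (I′ ∩ I ∷ S ∷ (I ∖ S′) ∪ (I′ ∩ R) ∷ S′ ∷ [])
  uncross₁ = total-mono (S′ ∩ S ∷ I ∷ (S ∖ I′) ∪ (S′ ∩ R) ∷ I′ ∷ []) (I′ ∩ I ∷ S ∷ (I ∖ S′) ∪ (I′ ∩ R) ∷ S′ ∷ []) pointwise
    where
    pointwise : ∀ i → countAt (S′ ∩ S ∷ I ∷ (S ∖ I′) ∪ (S′ ∩ R) ∷ I′ ∷ []) i ≤ countAt (I′ ∩ I ∷ S ∷ (I ∖ S′) ∪ (I′ ∩ R) ∷ S′ ∷ []) i
    pointwise i with mem? S i | mem? I i | mem? S′ i | mem? I′ i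
    ... | yes i∈S | yes i∈I | _        | _        = contradiction i∈S (I∩S=∅ i∈I)
    ... | _       | _       | yes i∈S′ | yes i∈I′ = contradiction i∈S′ (I′∩S′=∅ i∈I′)
    ... | yes _   | no  _   | yes _    | no  _    = ℕ.≤-refl
    ... | yes _   | no  _   | no  _    | yes _    = ℕ.≤-refl
    ... | yes _   | no  _   | no  _    | no  _    = ℕ.≤-refl
    ... | no  _   | yes _   | yes _    | no  _    = ℕ.≤-refl
    ... | no  _   | yes _   | no  _    | yes _    = ℕ.≤-refl
    ... | no  _   | yes _   | no  _    | no  _    = ℕ.≤-refl
    ... | no  _   | no  _   | yes _    | no  _    = ℕ.≤-refl
    ... | no  _   | no  _   | no  _    | yes _    = ℕ.≤-refl
    ... | no  _   | no  _   | no  _    | no  _    = ℕ.≤-refl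

  uncross₂ : total (S′ ∩ I ∷ I ∷ S′ ∩ S ∷ S ∪ (S′ ∩ R) ∷ I′ ∷ []) ≤ total (I′ ∩ S ∷ S ∷ I′ ∩ I ∷ I ∪ (I′ ∩ R) ∷ S′ ∷ [])
  uncross₂ = total-mono (S′ ∩ I ∷ I ∷ S′ ∩ S ∷ S ∪ (S′ ∩ R) ∷ I′ ∷ []) (I′ ∩ S ∷ S ∷ I′ ∩ I ∷ I ∪ (I′ ∩ R) ∷ S′ ∷ []) pointwise
    where
    pointwise : ∀ i → countAt (S′ ∩ I ∷ I ∷ S′ ∩ S ∷ S ∪ (S′ ∩ R) ∷ I′ ∷ []) i ≤ countAt (I′ ∩ S ∷ S ∷ I′ ∩ I ∷ I ∪ (I′ ∩ R) ∷ S′ ∷ []) i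
    pointwise i with mem? S i | mem? I i | mem? S′ i | mem? I′ i
    ... | yes i∈S | yes i∈I | _        | _        = contradiction i∈S (I∩S=∅ i∈I)
    ... | _       | _       | yes i∈S′ | yes i∈I′ = contradiction i∈S′ (I′∩S′=∅ i∈I′)
    ... | yes _   | no  _   | yes _    | no  _    = ℕ.≤-refl
    ... | yes _   | no  _   | no  _    | yes _    = ℕ.≤-refl
    ... | yes _   | no  _   | no  _    | no  _    = ℕ.≤-refl
    ... | no  _   | yes _   | yes _    | no  _    = ℕ.≤-refl
    ... | no  _   | yes _   | no  _    | yes _    = ℕ.≤-refl
    ... | no  _   | yes _   | no  _    | no  _    = ℕ.≤-refl
    ... | no  _   | no  _   | yes _    | no  _    = ℕ.≤-refl
    ... | no  _   | no  _   | no  _    | yes _    = ℕ.≤-refl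
    ... | no  _   | no  _   | no  _    | no  _    = ℕ.≤-refl

-- A vertex with many neighbours in `I₀`, and the two uncrossing cases

module Core {n} (G : Graph n) (d : ℕ) (d≤deg : ∀ v → d ≤ # (N G v))
  (tough : (J T : DecSet n) → (∀ {a} → Mem J a → ¬ Mem T a) →
           (∀ {a b} → Mem J a → Adj G a b → Mem T b) → # J ≤ # T)
  {u v : Fin n} (B : Barrier G d u v)
  where

  open Barrier B

  I₀ : DecSet n
  I₀ = I ∖ ⁅ u ⁆

  N⊆S : ∀ {t y} → Mem I₀ t → Adj G t y → Mem S y
  N⊆S (t∈I , t≢u) ty with N⊆ t∈I ty
  ... | inj₁ y∈S       = y∈S
  ... | inj₂ (t≡u , _) = contradiction t≡u t≢u

  #S≤1+#I₀ : # S ≤ 1 + # I₀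
  #S≤1+#I₀ = ℕ.≤-trans #S≤#I (#≤1+# I I₀ u remove-u)
    where
    remove-u : ∀ {i} → Mem I i → i ≡ u ⊎ Mem I₀ i
    remove-u {i} i∈I with i Fin.≟ u
    ... | yes i≡u = inj₁ i≡u
    ... | no  i≢u = inj₂ (i∈I , i≢u)

  d≤1+#S : d ≤ 1 + # S
  d≤1+#S = ℕ.≤-trans (d≤deg u) (#≤1+# (N G u) S v λ ui → Sum.swap (Sum.map₂ proj₂ (N⊆ p∈I ui)))

  2≤d : 2 ≤ d
  2≤d = ℕ.*-cancelˡ-≤ 2 (ℕ.≤-trans (ℕ.≤-trans (ℕ.n≤1+n 4) (ℕ.m≤n+m 5 (# S))) #S+5≤2d)

  richVertex : ∃[ s ] (Mem S s × d ≤ 1 + # (N G s ∩ I₀))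
  richVertex with Fin.any? (λ s → mem? S s ×-dec (d ℕ.≤? 1 + # (N G s ∩ I₀)))
  ... | yes s    = s
  -- Otherwise each `s` in `S` has at most `c = d − 2` neighbours in `I₀`, whereas a vertex of `I₀`
  -- has all of its at least `d` neighbours in `S`.
  ... | no  none with c , refl ← ℕ.m≤n⇒∃[o]m+o≡n 2≤d = ⊥-elim (richVertex-arith (# I₀) (# S) c
      (double-count G I₀ S c d
        (λ {s} s∈S → s≤s⁻¹ (s≤s⁻¹ (ℕ.≰⇒> λ d≤ → none (s , s∈S , d≤))))
        (λ {t} t∈I₀ → ℕ.≤-trans (d≤deg t) (#-mono (N G t) (N G t ∩ S) λ ty → ty , N⊆S t∈I₀ ty)))
      #S≤1+#I₀ d≤1+#S #S+5≤2d)
  module _ {s x : Fin n} (s∈S : Mem S s) (x∈I₀ : Mem I₀ x) (xs : Adj G x s) where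

    -- The barrier isolates `x`. Since `x` is the only neighbour of `s` in `I′`, the sets `I′ ∩ I₀`
    -- and `N G s ∩ I₀` share at most `x`; and `N G x` lies in `S′ ∩ S` together with `s`. Toughness
    -- is applied to `J` and `T`.
    case₁ : Barrier G d x s → # (N G s ∩ I₀) + d ≤ # S + 2
    case₁ B′ = case₁-arith (tough J T J∩T=∅ NJ⊆T) B′.#S≤#I (uncross₁ S I₀ S′ I′ (disjoint ∘ proj₁) B′.disjoint)
      (#+#≤1+# (I′ ∩ I₀) (N G s ∩ I₀) I₀ x proj₂ proj₂ λ (i∈I′ , _) (si , _) → I′∩Ns i∈I′ si)
      (ℕ.≤-trans (d≤deg x) (#≤1+# (N G x) (S′ ∩ S) s λ xi → Sum.swap (Sum.map (_, N⊆S x∈I₀ xi) proj₂ (B′.N⊆ B′.p∈I xi))))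
      where
      module B′ = Barrier B′
      S′ = B′.S
      I′ = B′.I
      R = ∁ (S ∪ I₀)
      T = (S ∖ I′) ∪ (S′ ∩ R)
      J = (I₀ ∖ S′) ∪ (I′ ∩ R)

      J∩T=∅ : ∀ {a} → Mem J a → ¬ Mem T a
      J∩T=∅ (inj₁ (a∈I₀ , _)) (inj₁ (a∈S , _)) = disjoint (proj₁ a∈I₀) a∈S
      J∩T=∅ (inj₁ (a∈I₀ , _)) (inj₂ (_ , a∈R)) = a∈R (inj₂ a∈I₀)
      J∩T=∅ (inj₂ (_ , a∈R)) (inj₁ (a∈S , _)) = a∈R (inj₁ a∈S)
      J∩T=∅ (inj₂ (a∈I′ , _)) (inj₂ (a∈S′ , _)) = B′.disjoint a∈I′ a∈S′

      NJ⊆T : ∀ {a b} → Mem J a → Adj G a b → Mem T b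
      NJ⊆T {a} {b} (inj₁ (a∈I₀ , a∉S′)) ab = inj₁ (N⊆S a∈I₀ ab , b∉I′)
        where
        b∉I′ : ¬ Mem I′ b
        b∉I′ b∈I′ with B′.N⊆ b∈I′ (adj-sym G ab)
        ... | inj₁ a∈S′       = a∉S′ a∈S′
        -- The exceptional edge would make `a` equal to `s`, which lies in `S` and not in `I₀`.
        ... | inj₂ (_ , refl) = disjoint (proj₁ a∈I₀) s∈S
      NJ⊆T {a} {b} (inj₂ (a∈I′ , a∈R)) ab with B′.N⊆ a∈I′ ab
      ... | inj₂ (refl , _) = contradiction (inj₂ x∈I₀) a∈R
      ... | inj₁ b∈S′ with mem? S b | mem? I₀ b
      ...   | yes b∈S | _        = inj₁ (b∈S , λ b∈I′ → B′.disjoint b∈I′ b∈S′)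
      ...   | no _    | yes b∈I₀ = contradiction (inj₁ (N⊆S b∈I₀ (adj-sym G ab))) a∈R
      ...   | no b∉S  | no b∉I₀  = inj₂ (b∈S′ , [ b∉S , b∉I₀ ]′)

      I′∩Ns : ∀ {i} → Mem I′ i → Adj G s i → i ≡ x
      I′∩Ns i∈I′ si with B′.N⊆ i∈I′ (adj-sym G si)
      ... | inj₁ s∈S′      = contradiction s∈S′ B′.q∉S
      ... | inj₂ (i≡x , _) = i≡x

    -- The barrier isolates `s`. Now `N G s ∩ I₀` lies in `S′ ∩ I₀` together with `x`, and inside
    -- `S` the sets `I′ ∩ S` and `N G x` share at most `s`. Toughness is applied to two pairs, the
    -- intersections and the unions of the barriers.
    case₂ : Barrier G d s x → # (N G s ∩ I₀) + d + # I₀ ≤ # S + # S + 2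
    case₂ B′ = case₂-arith (tough J₁ T₁ J₁∩T₁=∅ NJ₁⊆T₁) (tough J₂ T₂ J₂∩T₂=∅ NJ₂⊆T₂) B′.#S≤#I (uncross₂ S I₀ S′ I′ (disjoint ∘ proj₁) B′.disjoint)
      (#≤1+# (N G s ∩ I₀) (S′ ∩ I₀) x λ (si , i∈I₀) → Sum.swap (Sum.map (_, i∈I₀) proj₂ (B′.N⊆ B′.p∈I si)))
      (#+#≤1+# (I′ ∩ S) (N G x) S s proj₂ (N⊆S x∈I₀) I′∩S∩Nx)
      (d≤deg x)
      where
      module B′ = Barrier B′
      S′ = B′.S
      I′ = B′.I
      R = ∁ (S ∪ I₀)
      T₁ = S′ ∩ S
      J₁ = I′ ∩ I₀
      T₂ = S ∪ (S′ ∩ R)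
      J₂ = I₀ ∪ (I′ ∩ R)

      J₁∩T₁=∅ : ∀ {a} → Mem J₁ a → ¬ Mem T₁ a
      J₁∩T₁=∅ (a∈I′ , _) (a∈S′ , _) = B′.disjoint a∈I′ a∈S′

      NJ₁⊆T₁ : ∀ {a b} → Mem J₁ a → Adj G a b → Mem T₁ b
      NJ₁⊆T₁ (a∈I′ , a∈I₀) ab with B′.N⊆ a∈I′ ab
      ... | inj₁ b∈S′       = b∈S′ , N⊆S a∈I₀ ab
      ... | inj₂ (refl , _) = contradiction s∈S (disjoint (proj₁ a∈I₀))

      J₂∩T₂=∅ : ∀ {a} → Mem J₂ a → ¬ Mem T₂ a
      J₂∩T₂=∅ (inj₁ a∈I₀)       (inj₁ a∈S)        = disjoint (proj₁ a∈I₀) a∈S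
      J₂∩T₂=∅ (inj₁ a∈I₀)       (inj₂ (_ , a∈R))  = a∈R (inj₂ a∈I₀)
      J₂∩T₂=∅ (inj₂ (_ , a∈R))  (inj₁ a∈S)        = a∈R (inj₁ a∈S)
      J₂∩T₂=∅ (inj₂ (a∈I′ , _)) (inj₂ (a∈S′ , _)) = B′.disjoint a∈I′ a∈S′

      NJ₂⊆T₂ : ∀ {a b} → Mem J₂ a → Adj G a b → Mem T₂ b
      NJ₂⊆T₂ (inj₁ a∈I₀) ab = inj₁ (N⊆S a∈I₀ ab)
      NJ₂⊆T₂ {a} {b} (inj₂ (a∈I′ , a∈R)) ab with B′.N⊆ a∈I′ ab
      ... | inj₂ (refl , _) = contradiction (inj₁ s∈S) a∈R
      ... | inj₁ b∈S′ with mem? S b | mem? I₀ b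
      ...   | yes b∈S | _        = inj₁ b∈S
      ...   | no _    | yes b∈I₀ = contradiction (inj₁ (N⊆S b∈I₀ (adj-sym G ab))) a∈R
      ...   | no b∉S  | no b∉I₀  = inj₂ (b∈S′ , [ b∉S , b∉I₀ ]′)

      I′∩S∩Nx : ∀ {i} → Mem (I′ ∩ S) i → Adj G x i → i ≡ s
      I′∩S∩Nx (i∈I′ , _) xi with B′.N⊆ i∈I′ (adj-sym G xi)
      ... | inj₁ x∈S′      = contradiction x∈S′ B′.q∉S
      ... | inj₂ (i≡s , _) = i≡s

  noBarrier : (∀ {x s} → Adj G x s → Barrier G d x s ⊎ Barrier G d s x) → ⊥
  noBarrier barrier with s , s∈S , d≤ ← richVertex
    -- The `d − 1` neighbours of `s` in `I₀` include at least one, because `2 ≤ d`.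
    with x , sx , x∈I₀ ← #>0⇒nonempty (N G s ∩ I₀) (s≤s⁻¹ (ℕ.≤-trans 2≤d d≤))
    with barrier (adj-sym G sx)
  ... | inj₁ B′ = case₁-absurd d≤ (case₁ s∈S x∈I₀ (adj-sym G sx) B′) #S+5≤2d
  ... | inj₂ B′ = case₂-absurd d≤ #S≤1+#I₀ (case₂ s∈S x∈I₀ (adj-sym G sx) B′) #S+5≤2d

-- Triangle-freeness and the degree bound

girth4⇒triangle-free : (G : Graph n) → HasGirth G 4 → ∀ {a b c} → Adj G a b → Adj G b c → ¬ Adj G a c
girth4⇒triangle-free {n} G (_ , 4≤) {a} {b} {c} ab bc ac = ℕ.1+n≰n (4≤ triangle)
  where
  adj⇒≢ : ∀ {x y} → Adj G x y → x ≢ y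
  adj⇒≢ xy x≡y = adj-irrefl G x≡y xy

  vertex : Fin 3 → Fin n
  vertex zero             = a
  vertex (suc zero)       = b
  vertex (suc (suc zero)) = c

  distinct : ∀ {i j} → vertex i ≡ vertex j → i ≡ j
  distinct {zero}           {zero}           _  = refl
  distinct {zero}           {suc zero}       eq = contradiction eq (adj⇒≢ ab)
  distinct {zero}           {suc (suc zero)} eq = contradiction eq (adj⇒≢ ac)
  distinct {suc zero}       {zero}           eq = contradiction (sym eq) (adj⇒≢ ab)
  distinct {suc zero}       {suc zero}       _  = refl
  distinct {suc zero}       {suc (suc zero)} eq = contradiction eq (adj⇒≢ bc)
  distinct {suc (suc zero)} {zero}           eq = contradiction (sym eq) (adj⇒≢ ac)
  distinct {suc (suc zero)} {suc zero}       eq = contradiction (sym eq) (adj⇒≢ bc)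
  distinct {suc (suc zero)} {suc (suc zero)} _  = refl

  triangle : Cycle G
  triangle = record
    { m = 2 ; 2≤m = ℕ.≤-refl ; vertex = vertex ; distinct = distinct
    ; edge = λ { zero → ab ; (suc zero) → bc } ; closing = adj-sym G ac }

theorem2p2 : (n : ℕ) (G : Graph n) → MinimallyTough [ 1ℚ ] G → HasGirth G 4 →
    ∃[ v ] 4 * degree G v ≤ n + 6
theorem2p2 n G minimal@(τ≡1 , _) girth@((cycle , _) , _) with Fin.any? (λ v → 4 * degree G v ℕ.≤? n + 6)
... | yes low = low
-- The cycle supplies an edge for the first barrier; whichever of its ends is isolated, a
-- contradiction follows.
... | no ¬low = ⊥-elim ([ contra , contra ]′ (edgeBarrier (Cycle.closing cycle)))
  where
  d : ℕ
  -- The least integer above `(n + 6) / 4` as a rational number: every degree exceeds that quotient,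
  -- and `4d > n + 6`.
  d = suc ((n + 6) / 4)

  d≤deg : ∀ v → d ≤ # (N G v)
  d≤deg v = subst (d ≤_) (∣tabulate∣ (does ∘ adj? G v))
    (m<n*o⇒m/o<n (subst (n + 6 <_) (ℕ.*-comm 4 (degree G v)) (ℕ.≰⇒> λ deg≤ → ¬low (v , deg≤))))

  n+7≤4d : n + 7 ≤ 4 * d
  n+7≤4d = begin
    n + 7                                  ≡⟨ ℕ.+-suc n 6 ⟩
    suc (n + 6)                            ≡⟨ cong suc (m≡m%n+[m/n]*n (n + 6) 4) ⟩
    suc ((n + 6) % 4) + (n + 6) / 4 * 4    ≤⟨ ℕ.+-monoˡ-≤ _ (m%n<n (n + 6) 4) ⟩
    d * 4                                  ≡⟨ ℕ.*-comm d 4 ⟩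
    4 * d                                  ∎
    where open ℕ.≤-Reasoning

  edgeBarrier : ∀ {u v} → Adj G u v → Barrier G d u v ⊎ Barrier G d v u
  edgeBarrier = barrier G minimal (girth4⇒triangle-free G girth) d d≤deg n+7≤4d

  contra : ∀ {u v} → Barrier G d u v → ⊥
  contra B = Core.noBarrier G d d≤deg
    (independent⇒#≤ G τ≡1 (λ v → ℕ.≤-trans (s≤s z≤n) (d≤deg v))) B edgeBarrier
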